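{- Let $r\geq 3$ and let $G_1$ be the pan graph with vertex set $\{u_0,u_1,\dots,u_r\}$ and edge set $$E(G_1)=\{u_0u_r,\ u_1u_2,\ u_{r-1}u_r\}\cup\{u_ju_{j+2}: 1\le j\le r-2\}$$ (so $u_1,\dots,u_r$ span a cycle of length $r$ and $u_0$ is a pendant vertex attached to $u_r$). Let $H_0,H_1,\dots,H_r$ be connected graphs, each with at least two vertices, with $n_i=|V(H_i)|$, ordered so that $n_0\le n_1\le\dots\le n_r$. Let $\Gamma=G_1\diamond(H_0,H_1,\dots,H_r)$ be the generalized edge corona in which every vertex of $H_0$ is joined to $u_0$ and $u_r$, every vertex of $H_1$ is joined to $u_1$ and $u_2$, for each $j\in\{1,\dots,r-2\}$ every vertex of $H_{j+1}$ is joined to $u_j$ and $u_{j+2}$, and every vertex of $H_r$ is joined to $u_{r-1}$ and $u_r$. Suppose that (a) $\Delta(H_0)<\delta(H_1)$; (b) $\Delta(H_i)\le\delta(H_{i+1})$ for all $i\in\{1,\dots,r-1\}$; (c) $d'(u_0)\le\delta'(H_i)$ for all $i\in\{0,1,\dots,r\}$; (d) $\Delta'(H_r)\le d'(u_1)$. Then $\Gamma$ is antimagic.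
   Context: All graphs are simple and undirected. A graph $G$ is antimagic if there is a bijection $f:E(G)\to\{1,2,\dots,|E(G)|\}$ such that the vertex sums $w(v)=\sum_{e\ni v}f(e)$ are pairwise distinct over all vertices $v$. For a graph $G$ with $m$ edges $e_1,\dots,e_m$ and graphs $H_1,\dots,H_m$, the generalized edge corona $G\diamond(H_1,\dots,H_m)$ is obtained from disjoint copies of $G,H_1,\dots,H_m$ by joining both end vertices of $e_i$ to every vertex of $H_i$, for each $i$. $\Delta(H)$ and $\delta(H)$ denote the maximum and minimum degree of $H$ itself. For a vertex $v$ of $\Gamma$, $d'(v)$ denotes its degree in $\Gamma$; $\Delta'(H_i)$ and $\delta'(H_i)$ denote the maximum and minimum of $d'(v)$ over $v\in V(H_i)$ (so $d'(v)=\deg_{H_i}(v)+2$ for $v\in V(H_i)$). -}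

module Defs where

open import Data.Bool.Base using (if_then_else_)
open import Data.Fin.Base using (Fin; zero; suc; toℕ; fromℕ; inject₁)
import Data.Fin.Properties as Fin
open import Data.Fin.Relation.Unary.Top using (view; ‵fromℕ; ‵inject₁)
open import Data.List.Base using (List; []; _∷_; tabulate)
open import Data.List.Extrema.Nat using (max; min)
open import Data.Nat.Base using (ℕ; suc; _+_; _≤_; _<_; z≤n; s≤s)
import Data.Nat.Properties as ℕ
open import Data.Product.Base using (Σ; ∃-syntax; _×_; _,_; proj₁; proj₂)
open import Data.Product.Function.Dependent.Propositional using (Σ-↔)
open import Data.Sum.Base using (_⊎_; inj₁; inj₂)
open import Data.Sum.Function.Propositional using (_⊎-↔_)
open import Function.Base using (_∘_)
open import Function.Bundles using (_↔_; _⤖_; module Inverse; module Bijection; mk↔ₛ′)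
open import Function.Definitions using (Injective)
open import Function.Construct.Composition using (_↔-∘_)
open import Function.Construct.Identity using (↔-id)
open import Function.Construct.Symmetry using (↔-sym)
open import Function.Properties.Inverse using (↔⇒↣)
open import Relation.Binary.Construct.Closure.ReflexiveTransitive using (Star)
open import Relation.Binary.Definitions using (DecidableEquality)
open import Relation.Binary.PropositionalEquality
  using (_≡_; _≢_; refl; sym; trans; cong)
open import Relation.Nullary.Decidable using (Dec; does; _⊎-dec_; via-injection)
open import Relation.Nullary.Negation using (contradiction)

open import Algebra.Properties.CommutativeMonoid.Sum ℕ.+-0-commutativeMonoid
  using (sum)

record Finite (A : Set) : Set where
  field
    card : ℕ
    enum : A ↔ Fin card

  infix 4 _≟_
  _≟_ : DecidableEquality A
  _≟_ = via-injection (↔⇒↣ enum) Fin._≟_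

  ∑ : (A → ℕ) → ℕ
  ∑ f = sum (f ∘ Inverse.from enum)

  values : (A → ℕ) → List ℕ
  values f = tabulate (f ∘ Inverse.from enum)

open Finite using (card; enum)

maximum : List ℕ → ℕ
maximum = max 0

-- The value on [] is a dummy; it is only used for nonempty vertex sets.
minimum : List ℕ → ℕ
minimum []       = 0
minimum (n ∷ ns) = min n ns

finite-Fin : ∀ n → Finite (Fin n)
finite-Fin n = record { card = n ; enum = ↔-id (Fin n) }

finite-⊎ : ∀ {A B} → Finite A → Finite B → Finite (A ⊎ B)
finite-⊎ a b = record
  { card = card a + card b
  ; enum = ↔-sym Fin.+↔⊎ ↔-∘ (enum a ⊎-↔ enum b)
  }

private
  Σ-suc : ∀ {n} (B : Fin (suc n) → Set) →
          Σ (Fin (suc n)) B ↔ (B zero ⊎ Σ (Fin n) (B ∘ suc))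
  Σ-suc B = mk↔ₛ′
    (λ { (zero , b) → inj₁ b ; (suc i , b) → inj₂ (i , b) })
    (λ { (inj₁ b) → zero , b ; (inj₂ (i , b)) → suc i , b })
    (λ { (inj₁ b) → refl ; (inj₂ (i , b)) → refl })
    (λ { (zero , b) → refl ; (suc i , b) → refl })

  Σ-zero : (B : Fin 0 → Set) → Σ (Fin 0) B ↔ Fin 0
  Σ-zero B = mk↔ₛ′ proj₁ (λ ()) (λ ()) (λ { (() , _) })

finite-ΣFin : ∀ n {B : Fin n → Set} → (∀ i → Finite (B i)) → Finite (Σ (Fin n) B)
finite-ΣFin 0       {B} b = record { card = 0 ; enum = Σ-zero B }
finite-ΣFin (suc n) {B} b = record
  { card = card rest ; enum = enum rest ↔-∘ Σ-suc B }
  where rest = finite-⊎ (b zero) (finite-ΣFin n (b ∘ suc))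

finite-Σ : ∀ {A} {B : A → Set} → Finite A → (∀ a → Finite (B a)) → Finite (Σ A B)
finite-Σ {A} {B} a b = record
  { card = card fibres
  ; enum = enum fibres ↔-∘ ↔-sym (Σ-↔ (↔-sym (enum a)) (↔-id _))
  }
  where fibres = finite-ΣFin (card a) (b ∘ Inverse.from (enum a))

-- Each edge is listed once, with its two ends in an arbitrary order;
-- `simple` forbids parallel edges irrespective of that order.
record Graph : Set₁ where
  field
    V        : Set
    E        : Set
    finite-V : Finite V
    finite-E : Finite E
    ends     : E → V × V
    loopless : ∀ e → proj₁ (ends e) ≢ proj₂ (ends e)

  Joins : E → V → V → Set
  Joins e u v = ends e ≡ (u , v) ⊎ ends e ≡ (v , u)

  field
    simple   : ∀ {e e′ u v} → Joins e u v → Joins e′ u v → e ≡ e′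

  order : ℕ
  order = card finite-V

  size : ℕ
  size = card finite-E

  Adjacent : V → V → Set
  Adjacent u v = ∃[ e ] Joins e u v

  Connected : Set
  Connected = ∀ u v → Star Adjacent u v

  infix 4 _∈ends_ _∈ends?_
  _∈ends_ : V → E → Set
  v ∈ends e = v ≡ proj₁ (ends e) ⊎ v ≡ proj₂ (ends e)

  _∈ends?_ : ∀ v e → Dec (v ∈ends e)
  v ∈ends? e = (v ≟ proj₁ (ends e)) ⊎-dec (v ≟ proj₂ (ends e))
    where open Finite finite-V using (_≟_)

  ∑-incident : V → (E → ℕ) → ℕ
  ∑-incident v f =
    Finite.∑ finite-E (λ e → if does (v ∈ends? e) then f e else 0)

  degree : V → ℕ
  degree v = ∑-incident v (λ _ → 1)

  Δ : ℕ
  Δ = maximum (Finite.values finite-V degree)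

  δ : ℕ
  δ = minimum (Finite.values finite-V degree)

  -- Fin size is {0,…,size-1}, hence the shift by one.
  label : E ⤖ Fin size → E → ℕ
  label f e = suc (toℕ (Bijection.to f e))

  weight : E ⤖ Fin size → V → ℕ
  weight f v = ∑-incident v (label f)

  Antimagic : Set
  Antimagic = Σ (E ⤖ Fin size) λ f → Injective _≡_ _≡_ (weight f)

open Graph

pattern old v     = inj₁ v
pattern new e x   = inj₂ (e , x)

pattern base e    = inj₁ e
pattern inner e d = inj₂ (e , inj₁ d)
pattern join₁ e x = inj₂ (e , inj₂ (inj₁ x))
pattern join₂ e x = inj₂ (e , inj₂ (inj₂ x))

module Corona (G : Graph) (H : E G → Graph) where

  Vertex : Set
  Vertex = V G ⊎ Σ (E G) (λ e → V (H e))

  Edge : Set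
  Edge = E G ⊎ Σ (E G) (λ e → E (H e) ⊎ (V (H e) ⊎ V (H e)))

  endsᶜ : Edge → Vertex × Vertex
  endsᶜ (base e)    = old (proj₁ (ends G e)) , old (proj₂ (ends G e))
  endsᶜ (inner e d) = new e (proj₁ (ends (H e) d)) , new e (proj₂ (ends (H e) d))
  endsᶜ (join₁ e x) = old (proj₁ (ends G e)) , new e x
  endsᶜ (join₂ e x) = old (proj₂ (ends G e)) , new e x

  looplessᶜ : ∀ c → proj₁ (endsᶜ c) ≢ proj₂ (endsᶜ c)
  looplessᶜ (base e)    eq = loopless G e (old-injective eq)
    where
    old-injective : ∀ {u v} → _≡_ {A = Vertex} (old u) (old v) → u ≡ v
    old-injective refl = refl
  looplessᶜ (inner e d) eq = loopless (H e) d (new-injective eq)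
    where
    new-injective : ∀ {x y} → _≡_ {A = Vertex} (new e x) (new e y) → x ≡ y
    new-injective refl = refl
  looplessᶜ (join₁ e x) ()
  looplessᶜ (join₂ e x) ()

  private
    Joinsᶜ : Edge → Vertex → Vertex → Set
    Joinsᶜ c u v = endsᶜ c ≡ (u , v) ⊎ endsᶜ c ≡ (v , u)

    data Shape : Edge → Vertex → Vertex → Set where
      is-base  : ∀ {e u v} → Joins G e u v → Shape (base e) (old u) (old v)
      is-inner : ∀ {e d x y} → Joins (H e) d x y → Shape (inner e d) (new e x) (new e y)
      is-join₁ : ∀ {e x u} → u ≡ proj₁ (ends G e) → Shape (join₁ e x) (old u) (new e x)
      is-join₂ : ∀ {e x u} → u ≡ proj₂ (ends G e) → Shape (join₂ e x) (old u) (new e x)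
      is-nioj₁ : ∀ {e x u} → u ≡ proj₁ (ends G e) → Shape (join₁ e x) (new e x) (old u)
      is-nioj₂ : ∀ {e x u} → u ≡ proj₂ (ends G e) → Shape (join₂ e x) (new e x) (old u)

    shape : ∀ c {u v} → Joinsᶜ c u v → Shape c u v
    shape (base e)    (inj₁ refl) = is-base (inj₁ refl)
    shape (base e)    (inj₂ refl) = is-base (inj₂ refl)
    shape (inner e d) (inj₁ refl) = is-inner (inj₁ refl)
    shape (inner e d) (inj₂ refl) = is-inner (inj₂ refl)
    shape (join₁ e x) (inj₁ refl) = is-join₁ refl
    shape (join₁ e x) (inj₂ refl) = is-nioj₁ refl
    shape (join₂ e x) (inj₁ refl) = is-join₂ refl
    shape (join₂ e x) (inj₂ refl) = is-nioj₂ refl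

    unique : ∀ {c c′ u v} → Shape c u v → Shape c′ u v → c ≡ c′
    unique (is-base p)          (is-base q)      = cong inj₁ (simple G p q)
    unique (is-inner {e = e} p) (is-inner q)     =
      cong (λ d → inner e d) (simple (H e) p q)
    unique (is-join₁ p) (is-join₁ q) = refl
    unique (is-join₁ {e = e} p) (is-join₂ q) =
      contradiction (trans (sym p) q) (loopless G e)
    unique (is-join₂ {e = e} p) (is-join₁ q) =
      contradiction (trans (sym q) p) (loopless G e)
    unique (is-join₂ p) (is-join₂ q) = refl
    unique (is-nioj₁ p) (is-nioj₁ q) = refl
    unique (is-nioj₁ {e = e} p) (is-nioj₂ q) =
      contradiction (trans (sym p) q) (loopless G e)
    unique (is-nioj₂ {e = e} p) (is-nioj₁ q) =
      contradiction (trans (sym q) p) (loopless G e)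
    unique (is-nioj₂ p) (is-nioj₂ q) = refl

  corona : Graph
  corona = record
    { V        = Vertex
    ; E        = Edge
    ; finite-V = finite-⊎ (finite-V G) (finite-Σ (finite-E G) (λ e → finite-V (H e)))
    ; finite-E = finite-⊎ (finite-E G) (finite-Σ (finite-E G) λ e →
                   finite-⊎ (finite-E (H e)) (finite-⊎ (finite-V (H e)) (finite-V (H e))))
    ; ends     = endsᶜ
    ; loopless = looplessᶜ
    ; simple   = λ {c} {c′} p q → unique (shape c p) (shape c′ q)
    }

  Δ′ : E G → ℕ
  Δ′ e = maximum (Finite.values (finite-V (H e)) (λ x → degree corona (new e x)))

  δ′ : E G → ℕ
  δ′ e = minimum (Finite.values (finite-V (H e)) (λ x → degree corona (new e x)))

infix 5 _⋄_
_⋄_ : (G : Graph) → (E G → Graph) → Graph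
G ⋄ H = Corona.corona G H

last : ∀ {r} → Fin (suc r)
last {r} = fromℕ r

one : ∀ {r} → 3 ≤ r → Fin (suc r)
one (s≤s _) = suc zero

-- The vertex u_j is j, and the edges are numbered so that the graph
-- attached to edge i in the corona is H_i:
--   e_0 = u_0 u_r,  e_1 = u_1 u_2,  e_{j+1} = u_j u_{j+2} for 1 ≤ j ≤ r-2,
--   e_r = u_{r-1} u_r.
-- Below r = 3 + k, and ‵inject₁ i stands for j = toℕ i + 1.
pan-ends : ∀ {r} → 3 ≤ r → Fin (suc r) → Fin (suc r) × Fin (suc r)
pan-ends (s≤s (s≤s (s≤s z≤n))) zero       = zero , last
pan-ends (s≤s (s≤s (s≤s z≤n))) (suc zero) = suc zero , suc (suc zero)
pan-ends (s≤s (s≤s (s≤s z≤n))) (suc (suc i)) with view i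
... | ‵inject₁ i = suc (inject₁ (inject₁ i)) , suc (suc (suc i))
... | ‵fromℕ     = inject₁ last , last

module _ {r} (3≤r : 3 ≤ r) where

  private
    fst snd : Fin (suc r) → ℕ
    fst = toℕ ∘ proj₁ ∘ pan-ends 3≤r
    snd = toℕ ∘ proj₂ ∘ pan-ends 3≤r

  pan-ends-< : ∀ e → fst e < snd e
  pan-ends-< = go 3≤r
    where
    go : ∀ {r} (p : 3 ≤ r) e →
         toℕ (proj₁ (pan-ends p e)) < toℕ (proj₂ (pan-ends p e))
    go (s≤s (s≤s (s≤s z≤n))) zero       = s≤s z≤n
    go (s≤s (s≤s (s≤s z≤n))) (suc zero) = s≤s (s≤s z≤n)
    go (s≤s (s≤s (s≤s z≤n))) (suc (suc i)) with view i
    ... | ‵inject₁ i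
      rewrite Fin.toℕ-inject₁ (inject₁ i) | Fin.toℕ-inject₁ i =
      s≤s (s≤s (ℕ.n≤1+n _))
    ... | ‵fromℕ {n} rewrite Fin.toℕ-inject₁ (fromℕ n) = ℕ.≤-refl

  pan-ends-injective : Injective _≡_ _≡_ (pan-ends 3≤r)
  pan-ends-injective = go 3≤r _ _
    where
    fst-≡ : ∀ {k} i → toℕ (proj₁ (pan-ends (s≤s (s≤s (s≤s (z≤n {k})))) (suc (suc i))))
                    ≡ suc (toℕ i)
    fst-≡ i with view i
    ... | ‵inject₁ i = cong suc (Fin.toℕ-inject₁ (inject₁ i))
    ... | ‵fromℕ     = cong (λ n → suc (suc n)) (Fin.toℕ-inject₁ last)

    snd-≢ : ∀ {k} i → proj₂ (pan-ends (s≤s (s≤s (s≤s (z≤n {k})))) (suc (suc i)))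
                    ≢ suc (suc zero)
    snd-≢ i eq with view i
    snd-≢ _ () | ‵inject₁ _
    snd-≢ _ () | ‵fromℕ

    go : ∀ {r} (p : 3 ≤ r) e e′ → pan-ends p e ≡ pan-ends p e′ → e ≡ e′
    go (s≤s (s≤s (s≤s z≤n))) zero       zero       eq = refl
    go (s≤s (s≤s (s≤s z≤n))) (suc zero) (suc zero) eq = refl
    go (s≤s (s≤s (s≤s z≤n))) zero (suc (suc i)) eq =
      contradiction (trans (cong (toℕ ∘ proj₁) eq) (fst-≡ i)) λ ()
    go (s≤s (s≤s (s≤s z≤n))) (suc (suc i)) zero eq =
      contradiction (trans (cong (toℕ ∘ proj₁) (sym eq)) (fst-≡ i)) λ ()
    go (s≤s (s≤s (s≤s z≤n))) (suc zero) (suc (suc i)) eq =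
      contradiction (sym (cong proj₂ eq)) (snd-≢ i)
    go (s≤s (s≤s (s≤s z≤n))) (suc (suc i)) (suc zero) eq =
      contradiction (cong proj₂ eq) (snd-≢ i)
    go (s≤s (s≤s (s≤s z≤n))) (suc (suc i)) (suc (suc j)) eq =
      cong (λ i → suc (suc i)) (Fin.toℕ-injective (ℕ.suc-injective
        (trans (sym (fst-≡ i)) (trans (cong (toℕ ∘ proj₁) eq) (fst-≡ j)))))

  pan-simple : ∀ {e e′ u v} →
               pan-ends 3≤r e  ≡ (u , v) ⊎ pan-ends 3≤r e  ≡ (v , u) →
               pan-ends 3≤r e′ ≡ (u , v) ⊎ pan-ends 3≤r e′ ≡ (v , u) →
               e ≡ e′
  pan-simple {e} {e′} = λ
    { (inj₁ p) (inj₁ q) → pan-ends-injective (trans p (sym q))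
    ; (inj₂ p) (inj₂ q) → pan-ends-injective (trans p (sym q))
    ; (inj₁ p) (inj₂ q) → contradiction (ascending e′ q) (ℕ.<-asym (ascending e p))
    ; (inj₂ p) (inj₁ q) → contradiction (ascending e′ q) (ℕ.<-asym (ascending e p))
    }
    where
    ascending : ∀ e {u v} → pan-ends 3≤r e ≡ (u , v) → toℕ u < toℕ v
    ascending e refl = pan-ends-< e

pan : (r : ℕ) → 3 ≤ r → Graph
pan r 3≤r = record
  { V        = Fin (suc r)
  ; E        = Fin (suc r)
  ; finite-V = finite-Fin (suc r)
  ; finite-E = finite-Fin (suc r)
  ; ends     = pan-ends 3≤r
  ; loopless = λ e eq → ℕ.<⇒≢ (pan-ends-< 3≤r e) (cong toℕ eq)
  ; simple   = pan-simple 3≤r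
  }

{-# OPTIONS --safe #-}
-- Every edge e of G₁ is joined to its fibre H_e by two bundles of edges, one at each
-- end.  The labels 1, 2, … are given out in the order
--   bundle u₀-H₀, edge u₀u_r, edges inside H₀, …, H_r, the remaining bundles at
--   H₀, …, H_r, the remaining edges of G₁,
-- and the two bundles at H_i list the vertices of H_i by increasing sum of the labels
-- inside H_i.  The weights then increase along u₀, H₀, …, H_r, u₁, …, u_r: each
-- comparison matches the labels at a vertex injectively with labels at the next that are
-- at least as large, and the hypotheses on degrees and orders provide enough of these.
module Submission where

open import Defs
open import Data.Nat.Base using (ℕ; suc; _≤_; _<_)
open import Data.Fin.Base using (Fin; zero; suc; toℕ; inject₁)
open Graph using (order; Connected; Δ; δ; degree; Antimagic)
open Corona using (Δ′; δ′)

open import Algebra.Properties.CommutativeSemigroup as CommutativeSemigroup using ()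
open import Algebra.Properties.Semiring.Sum as Sum using ()
open import Data.Bool.Base using (true; false; if_then_else_)
open import Data.Fin.Base using (fromℕ; fromℕ<; splitAt)
open import Data.Fin.Patterns using (1F; 2F)
import Data.Fin.Properties as Fin
open import Data.Fin.Relation.Unary.Top using (View; view; view-fromℕ; view-inject₁; ‵fromℕ; ‵inject₁)
open import Data.List.Base using (List; []; _∷_)
open import Data.List.Extrema.Nat using (xs≤max; min≤⊤; min≤xs)
open import Data.List.Relation.Binary.Lex.Strict as Lex using (Lex-<; halt; this; next)
open import Data.List.Relation.Binary.Pointwise as Pointwise using (Pointwise; []; _∷_)
open import Data.List.Relation.Unary.All using (All; []; _∷_)
open import Data.List.Relation.Unary.All.Properties using (tabulate⁻)
open import Data.Nat.Base using (zero; _+_; _*_; z≤n; s≤s)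
import Data.Nat.Properties as ℕ
open import Data.Product.Base using (Σ; _,_; proj₁; proj₂)
open import Data.Sum.Base as ⊎ using (_⊎_; inj₁; inj₂)
open import Function.Base using (_∘_; id)
open import Function.Bundles using (_⤖_; mk⤖; module Inverse)
open import Function.Definitions using (Injective)
open import Relation.Binary.Definitions using (Trichotomous; tri<; tri≈; tri>)
open import Relation.Binary.PropositionalEquality
  using (_≡_; _≢_; refl; sym; trans; cong; cong₂; subst; subst₂; isEquivalence; module ≡-Reasoning)
open import Relation.Nullary.Decidable using (Dec; decidable-stable; yes; no; does; dec-true; dec-false)
open import Relation.Nullary.Negation using (¬_; contradiction)

open Finite using (card; enum; ∑; values)
open Graph using (V; E; finite-V; finite-E; ends; loopless; ∑-incident; _∈ends?_; label; weight)
open CommutativeSemigroup ℕ.+-commutativeSemigroup using (interchange)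
open Sum ℕ.+-*-semiring using (sum; sum-cong-≗; ∑-distrib-+; *-distribʳ-sum)

private
  variable
    A B : Set
    n : ℕ

-- Guarded terms and sums over `Fin n`.

infix 7 [_]·_
[_]·_ : {A : Set} → Dec A → ℕ → ℕ
[ p ]· n = if does p then n else 0

[]·-true : (p : Dec A) → A → [ p ]· n ≡ n
[]·-true p a rewrite dec-true p a = refl

[]·-false : (p : Dec A) → ¬ A → [ p ]· n ≡ 0
[]·-false p ¬a rewrite dec-false p ¬a = refl

[]·-cong : (p : Dec A) (q : Dec B) → (A → B) → (B → A) → [ p ]· n ≡ [ q ]· n
[]·-cong p (yes b) f g = []·-true p (g b)
[]·-cong p (no ¬b) f g = []·-false p (¬b ∘ f)

[]·-mono : (p : Dec A) (q : Dec B) → (A → B) → [ p ]· n ≤ [ q ]· n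
[]·-mono p (yes b) f with does p
... | true  = ℕ.≤-refl
... | false = z≤n
[]·-mono p (no ¬b) f = ℕ.≤-reflexive ([]·-false p (¬b ∘ f))

[]·-⊎ : {A B C : Set} (c : Dec C) (a : Dec A) (b : Dec B) →
        (C → A ⊎ B) → (A → C) → (B → C) → (A → ¬ B) → [ c ]· n ≡ [ a ]· n + [ b ]· n
[]·-⊎ c (yes a) (yes b) to fromᵃ fromᵇ disjoint = contradiction b (disjoint a)
[]·-⊎ c (yes a) (no _)  to fromᵃ fromᵇ disjoint =
  trans ([]·-true c (fromᵃ a)) (sym (ℕ.+-identityʳ _))
[]·-⊎ c (no _)  (yes b) to fromᵃ fromᵇ disjoint = []·-true c (fromᵇ b)
[]·-⊎ c (no ¬a) (no ¬b) to fromᵃ fromᵇ disjoint = []·-false c (⊎.[ ¬a , ¬b ] ∘ to)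

[]·-monoʳ : ∀ (p : Dec A) {m n} → m ≤ n → [ p ]· m ≤ [ p ]· n
[]·-monoʳ p m≤n with does p
... | true  = m≤n
... | false = z≤n

sum-zero : (f : Fin n → ℕ) → (∀ i → f i ≡ 0) → sum f ≡ 0
sum-zero {0}     f f≡0 = refl
sum-zero {suc n} f f≡0 = cong₂ _+_ (f≡0 zero) (sum-zero (f ∘ suc) (f≡0 ∘ suc))

sum-single : (f : Fin n → ℕ) (i : Fin n) → (∀ j → j ≢ i → f j ≡ 0) → sum f ≡ f i
sum-single f zero    f≡0 =
  trans (cong (f zero +_) (sum-zero (f ∘ suc) λ j → f≡0 (suc j) λ ())) (ℕ.+-identityʳ _)
sum-single f (suc i) f≡0 =
  cong₂ _+_ (f≡0 zero λ ())
    (sum-single (f ∘ suc) i λ j j≢i → f≡0 (suc j) (j≢i ∘ Fin.suc-injective))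

sum-const : ∀ n c → sum {n} (λ _ → c) ≡ n * c
sum-const 0       c = refl
sum-const (suc n) c = cong (c +_) (sum-const n c)

sum-mono-≤ : {f g : Fin n → ℕ} → (∀ i → f i ≤ g i) → sum f ≤ sum g
sum-mono-≤ {0}     f≤g = z≤n
sum-mono-≤ {suc n} f≤g = ℕ.+-mono-≤ (f≤g zero) (sum-mono-≤ (f≤g ∘ suc))

sum-mono-< : {f g : Fin n → ℕ} → (∀ i → f i ≤ g i) → ∀ i → f i < g i → sum f < sum g
sum-mono-< f≤g zero    fi<gi = ℕ.+-mono-<-≤ fi<gi (sum-mono-≤ (f≤g ∘ suc))
sum-mono-< f≤g (suc i) fi<gi = ℕ.+-mono-≤-< (f≤g zero) (sum-mono-< (f≤g ∘ suc) i fi<gi)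

term≤sum : (f : Fin n → ℕ) → ∀ i → f i ≤ sum f
term≤sum f zero    = ℕ.m≤m+n _ _
term≤sum f (suc i) = ℕ.≤-trans (term≤sum (f ∘ suc) i) (ℕ.m≤n+m _ _)

terms≤sum : (f : Fin n → ℕ) → ∀ {i j} → i ≢ j → f i + f j ≤ sum f
terms≤sum f {zero}  {zero}  i≢j = contradiction refl i≢j
terms≤sum f {zero}  {suc j} i≢j = ℕ.+-monoʳ-≤ (f zero) (term≤sum (f ∘ suc) j)
terms≤sum f {suc i} {zero}  i≢j =
  ℕ.≤-trans (ℕ.≤-reflexive (ℕ.+-comm (f (suc i)) (f zero)))
            (ℕ.+-monoʳ-≤ (f zero) (term≤sum (f ∘ suc) i))
terms≤sum f {suc i} {suc j} i≢j =
  ℕ.≤-trans (terms≤sum (f ∘ suc) (i≢j ∘ cong suc)) (ℕ.m≤n+m _ _)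

-- The term at `i` is kept exact and the other `n - 1` terms are replaced by `c`; the extra `c` on
-- the left stands in for the subtraction.
sum-bound-except : ∀ c (f : Fin n → ℕ) → (∀ i → f i ≤ c) → ∀ i → sum f + c ≤ f i + n * c
sum-bound-except {suc n} c f f≤c zero = begin
  f zero + sum (f ∘ suc) + c   ≡⟨ ℕ.+-assoc (f zero) _ c ⟩
  f zero + (sum (f ∘ suc) + c) ≤⟨ ℕ.+-monoʳ-≤ (f zero) (ℕ.+-monoˡ-≤ c (sum-mono-≤ (f≤c ∘ suc))) ⟩
  f zero + (sum {n} (λ _ → c) + c) ≡⟨ cong (λ s → f zero + (s + c)) (sum-const n c) ⟩
  f zero + (n * c + c)         ≡⟨ cong (f zero +_) (ℕ.+-comm (n * c) c) ⟩
  f zero + (c + n * c)         ∎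
  where open ℕ.≤-Reasoning
sum-bound-except {suc n} c f f≤c (suc i) = begin
  f zero + sum (f ∘ suc) + c     ≡⟨ ℕ.+-assoc (f zero) _ c ⟩
  f zero + (sum (f ∘ suc) + c)   ≤⟨ ℕ.+-mono-≤ (f≤c zero) (sum-bound-except c (f ∘ suc) (f≤c ∘ suc) i) ⟩
  c + (f (suc i) + n * c)        ≡⟨ ℕ.+-assoc c (f (suc i)) (n * c) ⟨
  c + f (suc i) + n * c          ≡⟨ cong (_+ n * c) (ℕ.+-comm c (f (suc i))) ⟩
  f (suc i) + c + n * c          ≡⟨ ℕ.+-assoc (f (suc i)) c (n * c) ⟩
  f (suc i) + (c + n * c)        ∎
  where open ℕ.≤-Reasoning

sum-splitAt : ∀ m {n} (f : Fin m ⊎ Fin n → ℕ) →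
              sum (f ∘ splitAt m) ≡ sum (f ∘ inj₁) + sum (f ∘ inj₂)
sum-splitAt 0       f = refl
sum-splitAt (suc m) f =
  trans (cong (f (inj₁ zero) +_) (sum-splitAt m (f ∘ ⊎.map suc id)))
        (sym (ℕ.+-assoc (f (inj₁ zero)) _ _))

-- Sums and extrema over finite types.

module _ (F : Finite A) where

  private
    to : A → Fin (card F)
    to = Inverse.to (enum F)
    from : Fin (card F) → A
    from = Inverse.from (enum F)

  index : A → ℕ
  index = toℕ ∘ to

  from-to : ∀ x → from (to x) ≡ x
  from-to = Inverse.strictlyInverseʳ (enum F)

  index-injective : Injective _≡_ _≡_ index
  index-injective {x} {y} eq =
    trans (sym (from-to x)) (trans (cong from (Fin.toℕ-injective eq)) (from-to y))

  ∑-cong : {f g : A → ℕ} → (∀ x → f x ≡ g x) → ∑ F f ≡ ∑ F g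
  ∑-cong f≡g = sum-cong-≗ (f≡g ∘ from)

  ∑-zero : (f : A → ℕ) → (∀ x → f x ≡ 0) → ∑ F f ≡ 0
  ∑-zero f f≡0 = sum-zero (f ∘ from) (f≡0 ∘ from)

  ∑-+ : (f g : A → ℕ) → ∑ F (λ x → f x + g x) ≡ ∑ F f + ∑ F g
  ∑-+ f g = ∑-distrib-+ (f ∘ from) (g ∘ from)

  ∑-*ʳ : ∀ (f : A → ℕ) c → ∑ F (λ x → f x * c) ≡ ∑ F f * c
  ∑-*ʳ f c = sym (*-distribʳ-sum c (f ∘ from))

  ∑-const : ∀ c → ∑ F (λ _ → c) ≡ card F * c
  ∑-const = sum-const (card F)

  ∑-mono-≤ : {f g : A → ℕ} → (∀ x → f x ≤ g x) → ∑ F f ≤ ∑ F g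
  ∑-mono-≤ f≤g = sum-mono-≤ (f≤g ∘ from)

  ∑-mono-< : {f g : A → ℕ} → (∀ x → f x ≤ g x) → ∀ x → f x < g x → ∑ F f < ∑ F g
  ∑-mono-< {f} {g} f≤g x fx<gx =
    sum-mono-< (f≤g ∘ from) (to x) (subst (λ y → f y < g y) (sym (from-to x)) fx<gx)

  ∑-bound-except : ∀ {c} (f : A → ℕ) → (∀ x → f x ≤ c) → ∀ x → ∑ F f + c ≤ f x + card F * c
  ∑-bound-except {c} f f≤c x =
    subst (λ y → ∑ F f + c ≤ f y + card F * c) (from-to x)
      (sum-bound-except c (f ∘ from) (f≤c ∘ from) (to x))

  ∑-single : (f : A → ℕ) (x : A) → (∀ y → y ≢ x → f y ≡ 0) → ∑ F f ≡ f x
  ∑-single f x f≡0 =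
    trans (sum-single (f ∘ from) (to x) λ i i≢x → f≡0 (from i) λ eq →
             i≢x (trans (sym (Inverse.strictlyInverseˡ (enum F) i)) (cong to eq)))
          (cong f (from-to x))

  ∑-[]-single : {P : A → Set} (P? : ∀ x → Dec (P x)) (f : A → ℕ) (x : A) →
                P x → (∀ y → P y → y ≡ x) → ∑ F (λ y → [ P? y ]· f y) ≡ f x
  ∑-[]-single P? f x Px unique =
    trans (∑-single (λ y → [ P? y ]· f y) x λ y y≢x → []·-false (P? y) (y≢x ∘ unique y)) ([]·-true (P? x) Px)

  ≤-maximum : ∀ f x → f x ≤ maximum (values F f)
  ≤-maximum f x = subst (λ y → f y ≤ maximum (values F f)) (from-to x)
    (tabulate⁻ (xs≤max 0 (values F f)) (to x))

  minimum-≤ : ∀ f x → minimum (values F f) ≤ f x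
  minimum-≤ f x = subst (λ y → minimum (values F f) ≤ f y) (from-to x)
    (tabulate⁻ (minimum≤xs (values F f)) (to x))
    where
    minimum≤xs : ∀ xs → All (minimum xs ≤_) xs
    minimum≤xs []       = []
    minimum≤xs (n ∷ ns) = min≤⊤ n ns ∷ min≤xs n ns

∑-⊎ : (F : Finite A) (G : Finite B) (f : A ⊎ B → ℕ) →
      ∑ (finite-⊎ F G) f ≡ ∑ F (f ∘ inj₁) + ∑ G (f ∘ inj₂)
∑-⊎ F G f = sum-splitAt (card F) (f ∘ ⊎.map (Inverse.from (enum F)) (Inverse.from (enum G)))

∑-ΣFin : ∀ n {B : Fin n → Set} (G : ∀ i → Finite (B i)) (f : Σ (Fin n) B → ℕ) →
         ∑ (finite-ΣFin n G) f ≡ sum (λ i → ∑ (G i) (λ y → f (i , y)))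
∑-ΣFin 0       G f = refl
∑-ΣFin (suc n) {B} G f = begin
  ∑ (finite-ΣFin (suc n) G) f
    ≡⟨ sum-cong-≗ from-rest ⟩
  ∑ rest f′
    ≡⟨ ∑-⊎ (G zero) (finite-ΣFin n (G ∘ suc)) f′ ⟩
  ∑ (G zero) (λ y → f (zero , y)) + ∑ (finite-ΣFin n (G ∘ suc)) (f′ ∘ inj₂)
    ≡⟨ cong (∑ (G zero) (λ y → f (zero , y)) +_) (∑-ΣFin n (G ∘ suc) (f′ ∘ inj₂)) ⟩
  ∑ (G zero) (λ y → f (zero , y)) + sum (λ i → ∑ (G (suc i)) (λ y → f (suc i , y)))
    ∎
  where
  open ≡-Reasoning
  rest = finite-⊎ (G zero) (finite-ΣFin n (G ∘ suc))
  f′ : B zero ⊎ Σ (Fin n) (B ∘ suc) → ℕ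
  f′ (inj₁ y)       = f (zero , y)
  f′ (inj₂ (i , y)) = f (suc i , y)
  -- Both sides are stuck on which summand index `i` falls into; once `splitAt` is decided they
  -- agree by computation.
  from-rest : ∀ i → f (Inverse.from (enum (finite-ΣFin (suc n) G)) i) ≡
                    f′ (Inverse.from (enum rest) i)
  from-rest i with splitAt (card (G zero)) i
  ... | inj₁ _ = refl
  ... | inj₂ _ = refl

∑-Σ : {B : A → Set} (F : Finite A) (G : ∀ x → Finite (B x)) (f : Σ A B → ℕ) →
      ∑ (finite-Σ F G) f ≡ ∑ F (λ x → ∑ (G x) (λ y → f (x , y)))
∑-Σ F G f = ∑-ΣFin (card F) (G ∘ Inverse.from (enum F))
                   (λ { (i , y) → f (Inverse.from (enum F) i , y) })

-- Lexicographic keys and the ranking that they induce.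

Key : Set
Key = List ℕ

infix 4 _≺_ _≺?_
-- A proper prefix precedes all its extensions. A truncated key can therefore serve as a threshold
-- lying just below every key that begins with it.
_≺_ : Key → Key → Set
_≺_ = Lex-< _≡_ _<_

_≺?_ : ∀ K L → Dec (K ≺ L)
_≺?_ = Lex.<-decidable ℕ._≟_ ℕ._<?_

≺-trans : ∀ {K L M} → K ≺ L → L ≺ M → K ≺ M
≺-trans = Lex.<-transitive isEquivalence ℕ.<-resp₂-≡ ℕ.<-trans

≺-irrefl : ∀ {K} → ¬ K ≺ K
≺-irrefl = Lex.<-irreflexive ℕ.<-irrefl (Pointwise.refl refl)

-- If `y` were missed, adjoining it as one more value would inject `Fin (suc n)` into `Fin n`.
injective⇒surjective : (f : Fin n → Fin n) → Injective _≡_ _≡_ f → ∀ y → Σ (Fin n) λ x → f x ≡ y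
injective⇒surjective {n} f f-inj y with Fin.any? (λ x → f x Fin.≟ y)
... | yes hit  = hit
... | no  miss = contradiction (Fin.injective⇒≤ g-injective) ℕ.1+n≰n
  where
  g : Fin (suc n) → Fin n
  g zero    = y
  g (suc x) = f x
  g-injective : Injective _≡_ _≡_ g
  g-injective {zero}  {zero}  eq = refl
  g-injective {zero}  {suc x} eq = contradiction (x , sym eq) miss
  g-injective {suc x} {zero}  eq = contradiction (x , eq) miss
  g-injective {suc x} {suc z} eq = cong suc (f-inj eq)

module Ranking (F : Finite A) (key : A → Key)
               (key-injective : ∀ x y → Pointwise _≡_ (key x) (key y) → x ≡ y) where

  -- The argument is an arbitrary key, not only the key of an element, so that `position` can also
  -- be evaluated at thresholds between groups of elements.
  position : Key → ℕ
  position K = ∑ F (λ x → [ key x ≺? K ]· 1)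

  position-mono : ∀ {K L} → K ≺ L → position K ≤ position L
  position-mono {K} {L} K≺L =
    ∑-mono-≤ F λ x → []·-mono (key x ≺? K) (key x ≺? L) λ k → ≺-trans k K≺L

  -- Strictness comes from `x` itself, which is counted below `K` but not below its own key.
  position-key : ∀ {x K} → key x ≺ K → position (key x) < position K
  position-key {x} {K} x≺K =
    ∑-mono-< F (λ y → []·-mono (key y ≺? key x) (key y ≺? K) λ k → ≺-trans k x≺K) x
      (subst (_< [ key x ≺? K ]· 1) (sym ([]·-false (key x ≺? key x) ≺-irrefl))
        (ℕ.≤-reflexive (sym ([]·-true (key x ≺? K) x≺K))))

  position<card : ∀ x → position (key x) < card F
  position<card x =
    subst (position (key x) <_) (trans (∑-const F 1) (ℕ.*-identityʳ _))
      (∑-mono-< F (λ y → []·-≤ (key y ≺? key x)) x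
        (s≤s (ℕ.≤-reflexive ([]·-false (key x ≺? key x) ≺-irrefl))))
    where
    []·-≤ : {B : Set} (p : Dec B) → [ p ]· 1 ≤ 1
    []·-≤ p with does p
    ... | true  = ℕ.≤-refl
    ... | false = z≤n

  position-key-injective : ∀ x y → position (key x) ≡ position (key y) → x ≡ y
  position-key-injective x y eq with Lex.<-compare sym ℕ.<-cmp (key x) (key y)
  ... | tri< x≺y _ _ = contradiction eq (ℕ.<⇒≢ (position-key x≺y))
  ... | tri≈ _ x≈y _ = key-injective x y x≈y
  ... | tri> _ _ y≺x = contradiction (sym eq) (ℕ.<⇒≢ (position-key y≺x))

  rank : A → Fin (card F)
  rank x = fromℕ< (position<card x)

  toℕ-rank : ∀ x → toℕ (rank x) ≡ position (key x)
  toℕ-rank x = Fin.toℕ-fromℕ< (position<card x)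

  rank-injective : Injective _≡_ _≡_ rank
  rank-injective {x} {y} eq = position-key-injective x y
    (trans (sym (toℕ-rank x)) (trans (cong toℕ eq) (toℕ-rank y)))

  ranking : A ⤖ Fin (card F)
  -- The counting argument concerns self-maps of `Fin n`, so `rank` is first precomposed with the
  -- enumeration.
  ranking = mk⤖ (rank-injective , λ i →
    let j , eq = injective⇒surjective (rank ∘ Inverse.from (enum F)) from-injective i
    in Inverse.from (enum F) j , λ { refl → eq })
    where
    from-injective : Injective _≡_ _≡_ (rank ∘ Inverse.from (enum F))
    from-injective {i} {j} eq =
      trans (sym (Inverse.strictlyInverseˡ (enum F) i))
        (trans (cong (Inverse.to (enum F)) (rank-injective eq)) (Inverse.strictlyInverseˡ (enum F) j))

-- Incident sums in a graph and in an edge corona.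

module Incidence (G : Graph) where

  private
    F = finite-E G

  ∑-incident-cong : ∀ v {f g : E G → ℕ} → (∀ e → f e ≡ g e) →
                    ∑-incident G v f ≡ ∑-incident G v g
  ∑-incident-cong v f≡g = ∑-cong F λ e → cong ([ _∈ends?_ G v e ]·_) (f≡g e)

  ∑-incident-const : ∀ v c → ∑-incident G v (λ _ → c) ≡ degree G v * c
  ∑-incident-const v c = trans (∑-cong F λ e → scale (does (_∈ends?_ G v e)))
    (∑-*ʳ F (λ e → [ _∈ends?_ G v e ]· 1) c)
    where
    scale : ∀ b → (if b then c else 0) ≡ (if b then 1 else 0) * c
    scale true  = sym (ℕ.*-identityˡ c)
    scale false = refl

  ∑-incident-mono : ∀ v {f g : E G → ℕ} → (∀ e → f e ≤ g e) →
                    ∑-incident G v f ≤ ∑-incident G v g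
  ∑-incident-mono v f≤g = ∑-mono-≤ F λ e → []·-monoʳ (_∈ends?_ G v e) (f≤g e)

  ∑-incident-≤ : ∀ v {c} {f : E G → ℕ} → (∀ e → f e ≤ c) → ∑-incident G v f ≤ degree G v * c
  ∑-incident-≤ v {c} f≤c = subst (_ ≤_) (∑-incident-const v c) (∑-incident-mono v f≤c)

  ∑-incident-≥ : ∀ v {c} {f : E G → ℕ} → (∀ e → c ≤ f e) → degree G v * c ≤ ∑-incident G v f
  ∑-incident-≥ v {c} c≤f = subst (_≤ _) (∑-incident-const v c) (∑-incident-mono v c≤f)

-- The function `g` is left arbitrary because two instances are wanted: the labels give vertex
-- weights, and the constant 1 gives degrees.
module CoronaIncidence (G : Graph) (H : E G → Graph) (g : E (G ⋄ H) → ℕ) where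

  private
    Γ = G ⋄ H

  -- The contribution of `e` to its first and to its second end: the edge itself together with the
  -- bundle from that end to the fibre.
  star₁ star₂ : E G → ℕ
  star₁ e = g (base e) + ∑ (finite-V (H e)) (λ x → g (join₁ e x))
  star₂ e = g (base e) + ∑ (finite-V (H e)) (λ x → g (join₂ e x))

  private
    infix 5 _∋?_
    _∋?_ : ∀ c v → Dec (Graph._∈ends_ Γ v c)
    c ∋? v = _∈ends?_ Γ v c

    term : V Γ → E Γ → ℕ
    term v c = [ c ∋? v ]· g c

    terms : V Γ → E G → ℕ
    terms v e =
      ∑ (finite-E (H e)) (λ d → term v (inner e d)) +
      (∑ (finite-V (H e)) (λ x → term v (join₁ e x)) +
       ∑ (finite-V (H e)) (λ x → term v (join₂ e x)))

    edges-split : ∀ v → ∑-incident Γ v g ≡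
      ∑ (finite-E G) (λ e → term v (base e)) + ∑ (finite-E G) (terms v)
    edges-split v = begin
      ∑ (finite-E Γ) (term v)
        ≡⟨ ∑-⊎ (finite-E G) fibres (term v) ⟩
      ∑ (finite-E G) bases + ∑ fibres (term v ∘ inj₂)
        ≡⟨ cong (∑ (finite-E G) bases +_) (∑-Σ (finite-E G) fibre (term v ∘ inj₂)) ⟩
      ∑ (finite-E G) bases + ∑ (finite-E G) (λ e → ∑ (fibre e) (λ c → term v (inj₂ (e , c))))
        ≡⟨ cong (∑ (finite-E G) bases +_) (∑-cong (finite-E G) split) ⟩
      ∑ (finite-E G) bases + ∑ (finite-E G) (terms v)
        ∎
      where
      open ≡-Reasoning
      bases : E G → ℕ
      bases e = term v (base e)
      fibre : ∀ e → Finite (E (H e) ⊎ (V (H e) ⊎ V (H e)))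
      fibre e = finite-⊎ (finite-E (H e)) (finite-⊎ (finite-V (H e)) (finite-V (H e)))
      fibres = finite-Σ (finite-E G) fibre
      split : ∀ e → ∑ (fibre e) (λ c → term v (inj₂ (e , c))) ≡ terms v e
      split e = trans
        (∑-⊎ (finite-E (H e)) (finite-⊎ (finite-V (H e)) (finite-V (H e)))
             (λ c → term v (inj₂ (e , c))))
        (cong (∑ (finite-E (H e)) (λ d → term v (inner e d)) +_)
          (∑-⊎ (finite-V (H e)) (finite-V (H e)) (λ c → term v (inj₂ (e , inj₂ c)))))

  -- Base edges and other fibres contribute nothing, and each of the two bundles at `e` has exactly
  -- one edge at `x`.
  incident-new : ∀ e x → ∑-incident Γ (new e x) g ≡
    ∑-incident (H e) x (λ d → g (inner e d)) + (g (join₁ e x) + g (join₂ e x))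
  incident-new e x = begin
    ∑-incident Γ v g
      ≡⟨ edges-split v ⟩
    ∑ (finite-E G) (λ e′ → term v (base e′)) + ∑ (finite-E G) (terms v)
      ≡⟨ cong₂ _+_ (∑-zero (finite-E G) (λ e′ → term v (base e′)) no-base)
                   (∑-single (finite-E G) (terms v) e other-terms) ⟩
    terms v e
      ≡⟨ cong₂ _+_ (∑-cong (finite-E (H e)) inner-terms)
           (cong₂ _+_
             (∑-[]-single (finite-V (H e)) (λ y → join₁ e y ∋? v) (λ y → g (join₁ e y)) x
                (inj₂ refl) λ { y (inj₂ refl) → refl })
             (∑-[]-single (finite-V (H e)) (λ y → join₂ e y ∋? v) (λ y → g (join₂ e y)) x
                (inj₂ refl) λ { y (inj₂ refl) → refl })) ⟩
    ∑-incident (H e) x (λ d → g (inner e d)) + (g (join₁ e x) + g (join₂ e x)) ∎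
    where
    open ≡-Reasoning
    v : V Γ
    v = new e x
    no-base : ∀ e′ → term v (base e′) ≡ 0
    no-base e′ = []·-false (base e′ ∋? v) λ { (inj₁ ()) ; (inj₂ ()) }
    other-terms : ∀ e′ → e′ ≢ e → terms v e′ ≡ 0
    other-terms e′ e′≢e = cong₂ _+_
      (∑-zero (finite-E (H e′)) (λ d → term v (inner e′ d)) λ d →
        []·-false (inner e′ d ∋? v) λ { (inj₁ refl) → e′≢e refl ; (inj₂ refl) → e′≢e refl })
      (cong₂ _+_
        (∑-zero (finite-V (H e′)) (λ y → term v (join₁ e′ y)) λ y →
          []·-false (join₁ e′ y ∋? v) λ { (inj₂ refl) → e′≢e refl })
        (∑-zero (finite-V (H e′)) (λ y → term v (join₂ e′ y)) λ y →
          []·-false (join₂ e′ y ∋? v) λ { (inj₂ refl) → e′≢e refl }))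
    inner-terms : ∀ d → term v (inner e d) ≡ [ _∈ends?_ (H e) x d ]· g (inner e d)
    inner-terms d = []·-cong (inner e d ∋? v) (_∈ends?_ (H e) x d)
      (λ { (inj₁ refl) → inj₁ refl ; (inj₂ refl) → inj₂ refl })
      (λ { (inj₁ refl) → inj₁ refl ; (inj₂ refl) → inj₂ refl })

  _at₁?_ : ∀ u e → Dec (u ≡ proj₁ (ends G e))
  u at₁? e = Finite._≟_ (finite-V G) u (proj₁ (ends G e))

  _at₂?_ : ∀ u e → Dec (u ≡ proj₂ (ends G e))
  u at₂? e = Finite._≟_ (finite-V G) u (proj₂ (ends G e))

  -- Since `G` is loopless, a base edge at `u` meets it at exactly one end, so its value can be
  -- grouped with the bundle at that end.
  incident-old : ∀ u → ∑-incident Γ (old u) g ≡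
    ∑ (finite-E G) (λ e → [ u at₁? e ]· star₁ e) + ∑ (finite-E G) (λ e → [ u at₂? e ]· star₂ e)
  incident-old u = begin
    ∑-incident Γ (old u) g
      ≡⟨ edges-split (old u) ⟩
    ∑ (finite-E G) (λ e → term (old u) (base e)) + ∑ (finite-E G) (terms (old u))
      ≡⟨ ∑-+ (finite-E G) (λ e → term (old u) (base e)) (terms (old u)) ⟨
    ∑ (finite-E G) (λ e → term (old u) (base e) + terms (old u) e)
      ≡⟨ ∑-cong (finite-E G) at ⟩
    ∑ (finite-E G) (λ e → [ u at₁? e ]· star₁ e + [ u at₂? e ]· star₂ e)
      ≡⟨ ∑-+ (finite-E G) (λ e → [ u at₁? e ]· star₁ e) (λ e → [ u at₂? e ]· star₂ e) ⟩
    ∑ (finite-E G) (λ e → [ u at₁? e ]· star₁ e) + ∑ (finite-E G) (λ e → [ u at₂? e ]· star₂ e)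
      ∎
    where
    open ≡-Reasoning

    -- A bundle lies at `u` either entirely or not at all, so one decision `p` governs the whole
    -- sum.
    at-joins : ∀ {X W : Set} (F : Finite X) (c : X → E Γ) (p : Dec W) →
               (∀ {x} → Graph._∈ends_ Γ (old u) (c x) → W) →
               (∀ {x} → W → Graph._∈ends_ Γ (old u) (c x)) →
               ∑ F (λ x → term (old u) (c x)) ≡ [ p ]· ∑ F (g ∘ c)
    at-joins F c (yes w) to from =
      ∑-cong F {g = g ∘ c} λ x → []·-true (c x ∋? old u) (from w)
    at-joins F c (no ¬w) to from =
      ∑-zero F (λ x → term (old u) (c x)) λ x → []·-false (c x ∋? old u) (¬w ∘ to)

    merge : ∀ b b′ m s s′ →
      (if b then m else 0) + (if b′ then m else 0) + ((if b then s else 0) + (if b′ then s′ else 0)) ≡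
      (if b then m + s else 0) + (if b′ then m + s′ else 0)
    merge true  true  m s s′ = interchange m m s s′
    merge true  false m s s′ =
      trans (cong₂ _+_ (ℕ.+-identityʳ m) (ℕ.+-identityʳ s)) (sym (ℕ.+-identityʳ (m + s)))
    merge false true  m s s′ = refl
    merge false false m s s′ = refl

    at : ∀ e → term (old u) (base e) + terms (old u) e ≡
               [ u at₁? e ]· star₁ e + [ u at₂? e ]· star₂ e
    at e = trans
      (cong₂ _+_
        ([]·-⊎ (base e ∋? old u) (u at₁? e) (u at₂? e)
          (λ { (inj₁ refl) → inj₁ refl ; (inj₂ refl) → inj₂ refl })
          (inj₁ ∘ cong inj₁) (inj₂ ∘ cong inj₁)
          (λ p q → loopless G e (trans (sym p) q)))
        (cong₂ _+_
          (∑-zero (finite-E (H e)) (λ d → term (old u) (inner e d)) λ d →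
            []·-false (inner e d ∋? old u) λ { (inj₁ ()) ; (inj₂ ()) })
          (cong₂ _+_
            (at-joins (finite-V (H e)) (λ x → join₁ e x) (u at₁? e)
              (λ { (inj₁ refl) → refl }) λ { refl → inj₁ refl })
            (at-joins (finite-V (H e)) (λ x → join₂ e x) (u at₂? e)
              (λ { (inj₁ refl) → refl }) λ { refl → inj₁ refl }))))
      (merge (does (u at₁? e)) (does (u at₂? e)) (g (base e)) _ _)

∑-[]-none : (F : Finite A) {P : A → Set} (P? : ∀ x → Dec (P x)) (f : A → ℕ) →
            (∀ x → ¬ P x) → ∑ F (λ x → [ P? x ]· f x) ≡ 0
∑-[]-none F P? f ¬P = ∑-zero F (λ x → [ P? x ]· f x) λ x → []·-false (P? x) (¬P x)

-- The pan graph with r = 3 + k, and the incident sums at its vertices.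

module Pan (k : ℕ) where

  3≤3+k : 3 ≤ 3 + k
  3≤3+k = s≤s (s≤s (s≤s z≤n))

  G : Graph
  G = pan (3 + k) 3≤3+k

  fst snd : Fin (4 + k) → Fin (4 + k)
  fst e = proj₁ (ends G e)
  snd e = proj₂ (ends G e)

  -- Together with `snd-1+` this hides the case split in `pan-ends`: e_i runs from u_{i-1} to
  -- u_{i+1}, apart from both ends of e_0, the first end of e_1 and the second end of e_r.
  fst-2+ : ∀ i → fst (suc (suc i)) ≡ suc (inject₁ i)
  fst-2+ i with view i
  ... | ‵inject₁ _ = refl
  ... | ‵fromℕ     = refl

  snd-1+ : ∀ i → snd (suc (inject₁ i)) ≡ suc (suc i)
  snd-1+ zero    = refl
  snd-1+ (suc i) rewrite view-inject₁ i = refl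

  snd-last : snd last ≡ last
  snd-last rewrite view-fromℕ (suc k) = refl

  zero≢snd : ∀ e → zero ≢ snd e
  zero≢snd e eq = contradiction (subst (toℕ (fst e) <_) (cong toℕ (sym eq)) (pan-ends-< 3≤3+k e)) λ ()

  one≢snd : ∀ e → 1F ≢ snd e
  one≢snd zero    ()
  one≢snd (suc i) eq with view i
  ... | ‵inject₁ i = contradiction (trans eq (snd-1+ i)) λ ()
  ... | ‵fromℕ     = contradiction (trans eq snd-last) λ ()

  zero≡fst : ∀ e → zero ≡ fst e → e ≡ zero
  zero≡fst zero          eq = refl
  zero≡fst (suc (suc i)) eq = contradiction (trans eq (fst-2+ i)) λ ()

  fst-middle : ∀ i e → suc (suc (inject₁ i)) ≡ fst e → e ≡ suc (suc (suc i))
  fst-middle i zero          ()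
  fst-middle i 1F            ()
  fst-middle i (suc (suc j)) eq =
    cong (λ j → suc (suc j)) (sym (Fin.inject₁-injective (Fin.suc-injective (trans eq (fst-2+ j)))))

  snd-middle : ∀ i e → suc (suc (inject₁ i)) ≡ snd e → e ≡ suc (inject₁ (inject₁ i))
  snd-middle i zero    eq =
    contradiction (sym (Fin.suc-injective (Fin.suc-injective eq))) Fin.fromℕ≢inject₁
  snd-middle i (suc j) eq with view j
  ... | ‵inject₁ j =
    cong (λ j → suc (inject₁ j)) (sym (Fin.suc-injective (Fin.suc-injective (trans eq (snd-1+ j)))))
  ... | ‵fromℕ     =
    contradiction (sym (Fin.suc-injective (Fin.suc-injective (trans eq snd-last)))) Fin.fromℕ≢inject₁

  module PanCorona (H : Fin (4 + k) → Graph) (g : E (G ⋄ H) → ℕ) where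

    open CoronaIncidence G H g public

    private
      F = finite-E G

      W : Fin (4 + k) → ℕ
      W u = ∑-incident (G ⋄ H) (old u) g

    incident-u₀ : W zero ≡ star₁ zero
    incident-u₀ = trans (incident-old zero) (trans
      (cong₂ _+_ (∑-[]-single F (zero at₁?_) star₁ zero refl (λ e eq → zero≡fst e eq))
                 (∑-[]-none F (zero at₂?_) star₂ zero≢snd))
      (ℕ.+-identityʳ (star₁ zero)))

    incident-u₁ : W 1F ≡ star₁ 1F + star₁ 2F
    incident-u₁ = trans (incident-old 1F) (trans
      -- Two edges start at u₁, so `∑-[]-single` does not apply to the whole sum: e_0 and e_1 are
      -- peeled off, and among the rest only e_2 remains.
      (cong₂ _+_ (cong₂ _+_ ([]·-false {n = star₁ zero} (1F at₁? zero) λ ())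
                   (cong₂ _+_ ([]·-true {n = star₁ 1F} (1F at₁? 1F) refl)
                     (∑-[]-single (finite-Fin (2 + k)) (λ i → 1F at₁? suc (suc i))
                        (λ i → star₁ (suc (suc i))) zero refl only-zero)))
                 (∑-[]-none F (1F at₂?_) star₂ one≢snd))
      (ℕ.+-identityʳ (star₁ 1F + star₁ 2F)))
      where
      only-zero : ∀ i → 1F ≡ fst (suc (suc i)) → i ≡ zero
      only-zero i eq = Fin.inject₁-injective (sym (Fin.suc-injective (trans eq (fst-2+ i))))

    incident-middle : ∀ i → W (suc (suc (inject₁ i))) ≡
                            star₁ (suc (suc (suc i))) + star₂ (suc (inject₁ (inject₁ i)))
    incident-middle i = trans (incident-old u) (cong₂ _+_
      (∑-[]-single F (u at₁?_) star₁ (suc (suc (suc i))) (sym (fst-2+ (suc i))) (fst-middle i))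
      (∑-[]-single F (u at₂?_) star₂ (suc (inject₁ (inject₁ i))) (sym (snd-1+ (inject₁ i)))
         (snd-middle i)))
      where
      u : Fin (4 + k)
      u = suc (suc (inject₁ i))

    -- An inequality is stated because u_r is also an end of e_0; only the contributions of e_{r-1}
    -- and e_r are kept.
    incident-last : star₂ (suc (inject₁ last)) + star₂ last ≤ W last
    incident-last = begin
      star₂ (suc (inject₁ last)) + star₂ last
        ≡⟨ cong₂ _+_ ([]·-true (last at₂? suc (inject₁ last)) (sym (snd-1+ last)))
                     ([]·-true (last at₂? last) (sym snd-last)) ⟨
      [ last at₂? suc (inject₁ last) ]· star₂ (suc (inject₁ last)) + [ last at₂? last ]· star₂ last
        ≤⟨ terms≤sum (λ e → [ last at₂? e ]· star₂ e)
             (λ eq → Fin.fromℕ≢inject₁ (sym (Fin.suc-injective eq))) ⟩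
      ∑ F (λ e → [ last at₂? e ]· star₂ e)
        ≤⟨ ℕ.m≤n+m (∑ F λ e → [ last at₂? e ]· star₂ e) (∑ F λ e → [ last at₁? e ]· star₁ e) ⟩
      ∑ F (λ e → [ last at₁? e ]· star₁ e) + ∑ F (λ e → [ last at₂? e ]· star₂ e)
        ≡⟨ incident-old last ⟨
      W last ∎
      where open ℕ.≤-Reasoning

-- The two inequalities alternate along i, i+1, ..., j. It is applied to minimum and maximum
-- degrees, and with `lo` equal to `hi` to the orders.
chain : (lo hi : Fin (suc n) → ℕ) → (∀ i → lo i ≤ hi i) → (∀ i → hi (inject₁ i) ≤ lo (suc i)) →
        ∀ i j → toℕ i < toℕ j → hi i ≤ lo j
chain lo hi lo≤hi step zero (suc zero) _ = step zero
chain lo hi lo≤hi step zero (suc (suc j)) _ =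
  ℕ.≤-trans (step zero) (ℕ.≤-trans (lo≤hi (suc zero))
    (chain (lo ∘ suc) (hi ∘ suc) (lo≤hi ∘ suc) (step ∘ suc) zero (suc j) (s≤s z≤n)))
chain {suc n} lo hi lo≤hi step (suc i) (suc j) (s≤s i<j) =
  chain (lo ∘ suc) (hi ∘ suc) (lo≤hi ∘ suc) (step ∘ suc) i j i<j

-- The labelling of the corona.

module Labelling (k : ℕ) (H : Fin (4 + k) → Graph) where

  open Pan k using (G)

  Γ : Graph
  Γ = G ⋄ H

  -- t i x is to be the sum of the labels at x inside H_i.  It only orders the bundles, so
  -- the labels inside the fibres do not depend on it (position-inner), which breaks the
  -- circularity in the definition of inner-weight.
  Tiebreak : Set
  Tiebreak = ∀ i → V (H i) → ℕ

  tie : Tiebreak → ∀ i → V (H i) → Key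
  tie t i x = t i x ∷ index (finite-V (H i)) x ∷ []

  -- The head of a key is the group of the edge: 0 for the bundle u₀-H₀, 1 for u₀u_r, 2 for edges
  -- inside fibres, 3 for the remaining bundles, 4 for the remaining edges of the pan.
  base-group join₁-group : Fin (4 + k) → ℕ
  base-group zero    = 1
  base-group (suc _) = 4
  join₁-group zero    = 0
  join₁-group (suc _) = 3

  key : Tiebreak → E Γ → Key
  key t (inner i d) = 2 ∷ toℕ i ∷ index (finite-E (H i)) d ∷ []
  key t (join₁ i x) = join₁-group i ∷ toℕ i ∷ 0 ∷ tie t i x
  key t (join₂ i x) = 3 ∷ toℕ i ∷ 1 ∷ tie t i x
  key t (base i)    = base-group i ∷ toℕ i ∷ []

  tie-injective : ∀ t {i} {x y : V (H i)} → Pointwise _≡_ (tie t i x) (tie t i y) → x ≡ y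
  tie-injective t {i} (_ ∷ p ∷ []) = index-injective (finite-V (H i)) p

  -- Base, inner and bundle keys have lengths 2, 3 and 5, and the two kinds of bundle differ in the
  -- third entry. Within one kind the entries determine the edge.
  key-injective : ∀ t c c′ → Pointwise _≡_ (key t c) (key t c′) → c ≡ c′
  key-injective t (inner i d) (inner j d′) (_ ∷ p ∷ q ∷ []) with Fin.toℕ-injective p
  ... | refl = cong (λ d → inner i d) (index-injective (finite-E (H i)) q)
  key-injective t (join₁ i x) (join₁ j y) (_ ∷ p ∷ refl ∷ q) with Fin.toℕ-injective p
  ... | refl = cong (λ x → join₁ i x) (tie-injective t q)
  key-injective t (join₂ i x) (join₂ j y) (_ ∷ p ∷ refl ∷ q) with Fin.toℕ-injective p
  ... | refl = cong (λ x → join₂ i x) (tie-injective t q)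
  key-injective t (base i) (base j) (_ ∷ p ∷ []) = cong base (Fin.toℕ-injective p)
  key-injective t (inner i d) (join₁ j y) (_ ∷ _ ∷ _ ∷ ())
  key-injective t (inner i d) (join₂ j y) (_ ∷ _ ∷ _ ∷ ())
  key-injective t (inner i d) (base j)    (_ ∷ _ ∷ ())
  key-injective t (join₁ i x) (inner j d) (_ ∷ _ ∷ _ ∷ ())
  key-injective t (join₁ i x) (join₂ j y) (_ ∷ _ ∷ () ∷ _)
  key-injective t (join₁ i x) (base j)    (_ ∷ _ ∷ ())
  key-injective t (join₂ i x) (inner j d) (_ ∷ _ ∷ _ ∷ ())
  key-injective t (join₂ i x) (join₁ j y) (_ ∷ _ ∷ () ∷ _)
  key-injective t (join₂ i x) (base j)    (_ ∷ _ ∷ ())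
  key-injective t (base i)    (inner j d) (_ ∷ _ ∷ ())
  key-injective t (base i)    (join₁ j y) (_ ∷ _ ∷ ())
  key-injective t (base i)    (join₂ j y) (_ ∷ _ ∷ ())

  module R (t : Tiebreak) = Ranking (finite-E Γ) (key t) (key-injective t)

  position-inner : ∀ t t′ i d → R.position t (key t (inner i d)) ≡ R.position t′ (key t′ (inner i d))
  position-inner t t′ i d = ∑-cong (finite-E Γ) same
    where
    same : ∀ c → [ key t c ≺? key t (inner i d) ]· 1 ≡ [ key t′ c ≺? key t′ (inner i d) ]· 1
    -- Inner keys do not mention the tiebreak, and every other key has a head different from 2, so
    -- its comparison is settled before the tiebreak is reached.
    same (inner j d′)      = refl
    same (join₁ zero x)    = refl
    same (join₁ (suc j) x) = refl
    same (join₂ j x)       = refl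
    same (base zero)       = refl
    same (base (suc j))    = refl

  -- The zero tiebreak is a dummy. By `position-inner` these are the labels that the final ranking
  -- gives; the successor is there because labels start at 1.
  inner-weight : Tiebreak
  inner-weight i x =
    ∑-incident (H i) x λ d → suc (R.position (λ _ _ → 0) (key (λ _ _ → 0) (inner i d)))

  open R inner-weight public

  κ : E Γ → Key
  κ = key inner-weight

  ℓ : E Γ → ℕ
  ℓ = label Γ ranking

  W : V Γ → ℕ
  W = weight Γ ranking

  open Pan.PanCorona k H ℓ public

  ℓ≡1+position : ∀ c → ℓ c ≡ suc (position (κ c))
  ℓ≡1+position c = cong suc (toℕ-rank c)

  ℓ-mono : ∀ c c′ → κ c ≺ κ c′ → ℓ c < ℓ c′
  ℓ-mono c c′ c≺c′ = subst₂ _<_ (sym (ℓ≡1+position c)) (sym (ℓ≡1+position c′)) (s≤s (position-key c≺c′))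

  -- Exactly `position K` edges lie below a threshold `K`, and labels start at 1. Hence `position K`
  -- separates the labels below `K` from those above, which `position<ℓ` bounds.
  ℓ≤position : ∀ c K → κ c ≺ K → ℓ c ≤ position K
  ℓ≤position c K c≺K = subst (_≤ position K) (sym (ℓ≡1+position c)) (position-key c≺K)

  position<ℓ : ∀ c K → K ≺ κ c → position K < ℓ c
  position<ℓ c K K≺c = subst (position K <_) (sym (ℓ≡1+position c)) (s≤s (position-mono K≺c))

  W-new : ∀ i x → W (new i x) ≡ inner-weight i x + (ℓ (join₁ i x) + ℓ (join₂ i x))
  W-new i x = trans (incident-new i x) (cong (_+ (ℓ (join₁ i x) + ℓ (join₂ i x)))
    (Incidence.∑-incident-cong (H i) x λ d →
      trans (ℓ≡1+position (inner i d)) (cong suc (position-inner inner-weight (λ _ _ → 0) i d))))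

≉⇒<⊎> : {_≈_ _⊏_ : A → A → Set} → Trichotomous _≈_ _⊏_ → ∀ {x y} → ¬ x ≈ y → x ⊏ y ⊎ y ⊏ x
≉⇒<⊎> compare {x} {y} x≉y with compare x y
... | tri< x⊏y _ _ = inj₁ x⊏y
... | tri≈ _ x≈y _ = contradiction x≈y x≉y
... | tri> _ _ y⊏x = inj₂ y⊏x

-- Comparison of the weights.

module Weights (k : ℕ) (H : Fin (4 + k) → Graph)
  (order≥2    : ∀ i → 2 ≤ order (H i))
  (order-step : ∀ (i : Fin (3 + k)) → order (H (inject₁ i)) ≤ order (H (suc i)))
  (Δ≤δ        : ∀ (i : Fin (3 + k)) → Δ (H (inject₁ i)) ≤ δ (H (suc i)))
  (u₀≤δ′      : degree (Pan.G k ⋄ H) (old zero) ≤ δ′ (Pan.G k) H zero)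
  (Δ′≤u₁      : Δ′ (Pan.G k) H last ≤ degree (Pan.G k ⋄ H) (old 1F))
  where

  open Pan k using (G)
  open Labelling k H

  open ℕ.≤-Reasoning

  deg : ∀ i → V (H i) → ℕ
  deg i = degree (H i)

  some : ∀ i → V (H i)
  some i = Inverse.from (enum (finite-V (H i))) (fromℕ< (ℕ.<⇒≤ (order≥2 i)))

  deg≤Δ : ∀ i x → deg i x ≤ Δ (H i)
  deg≤Δ i = ≤-maximum (finite-V (H i)) (deg i)

  δ≤deg : ∀ i x → δ (H i) ≤ deg i x
  δ≤deg i = minimum-≤ (finite-V (H i)) (deg i)

  deg-mono : ∀ i j → toℕ i < toℕ j → ∀ x y → deg i x ≤ deg j y
  deg-mono i j i<j x y = begin
    deg i x ≤⟨ deg≤Δ i x ⟩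
    Δ (H i) ≤⟨ chain (δ ∘ H) (Δ ∘ H) (λ i → ℕ.≤-trans (δ≤deg i (some i)) (deg≤Δ i (some i))) Δ≤δ i j i<j ⟩
    δ (H j) ≤⟨ δ≤deg j y ⟩
    deg j y ∎

  order-mono : ∀ i j → toℕ i < toℕ j → order (H i) ≤ order (H j)
  order-mono = chain (order ∘ H) (order ∘ H) (λ _ → ℕ.≤-refl) order-step

  degree-new : ∀ i x → degree Γ (new i x) ≡ deg i x + 2
  degree-new i x = CoronaIncidence.incident-new G H (λ _ → 1) i x

  -- In the corona u₀ has degree n₀ + 1 and `x` has degree `deg zero x + 2`; condition (c) for H₀
  -- compares the two.
  order₀≤1+deg : ∀ x → order (H zero) ≤ suc (deg zero x)
  order₀≤1+deg x = ℕ.≤-pred (begin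
    suc (order (H zero))
      ≡⟨ cong suc (trans (∑-const (finite-V (H zero)) 1) (ℕ.*-identityʳ _)) ⟨
    suc (∑ (finite-V (H zero)) (λ _ → 1))
      ≡⟨ Pan.PanCorona.incident-u₀ k H (λ _ → 1) ⟨
    degree Γ (old zero)
      ≤⟨ u₀≤δ′ ⟩
    δ′ G H zero
      ≤⟨ minimum-≤ (finite-V (H zero)) (λ y → degree Γ (new zero y)) x ⟩
    degree Γ (new zero x)
      ≡⟨ degree-new zero x ⟩
    deg zero x + 2
      ≡⟨ ℕ.+-comm (deg zero x) 2 ⟩
    suc (suc (deg zero x)) ∎)

  -- Condition (d), with the two edges joining `x` to the pan cancelled against the edges u₁u₂ and
  -- u₁u₃ at u₁.
  deg-last≤ : ∀ x → deg last x ≤ order (H 1F) + order (H 2F)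
  deg-last≤ x = ℕ.+-cancelʳ-≤ 2 _ _ (begin
    deg last x + 2
      ≡⟨ degree-new last x ⟨
    degree Γ (new last x)
      ≤⟨ ≤-maximum (finite-V (H last)) (λ y → degree Γ (new last y)) x ⟩
    Δ′ G H last
      ≤⟨ Δ′≤u₁ ⟩
    degree Γ (old 1F)
      ≡⟨ Pan.PanCorona.incident-u₁ k H (λ _ → 1) ⟩
    suc (∑ (finite-V (H 1F)) (λ _ → 1)) + suc (∑ (finite-V (H 2F)) (λ _ → 1))
      ≡⟨ cong₂ (λ m n → suc m + suc n)
           (trans (∑-const (finite-V (H 1F)) 1) (ℕ.*-identityʳ _))
           (trans (∑-const (finite-V (H 2F)) 1) (ℕ.*-identityʳ _)) ⟩
    suc (order (H 1F)) + suc (order (H 2F))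
      ≡⟨ cong suc (ℕ.+-suc (order (H 1F)) (order (H 2F))) ⟩
    2 + (order (H 1F) + order (H 2F))
      ≡⟨ ℕ.+-comm 2 (order (H 1F) + order (H 2F)) ⟩
    order (H 1F) + order (H 2F) + 2 ∎)

  -- Two expressions for the weight of `x` are available; cancelling the two bundle labels leaves
  -- this.
  inner-weight≡ : ∀ i x → inner-weight i x ≡ ∑-incident (H i) x (λ d → ℓ (inner i d))
  inner-weight≡ i x = ℕ.+-cancelʳ-≡ (ℓ (join₁ i x) + ℓ (join₂ i x)) _ _
    (trans (sym (W-new i x)) (incident-new i x))

  inner-weight-≤ : ∀ i x K → (∀ d → κ (inner i d) ≺ K) → inner-weight i x ≤ deg i x * position K
  inner-weight-≤ i x K below = begin
    inner-weight i x ≡⟨ inner-weight≡ i x ⟩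
    ∑-incident (H i) x (λ d → ℓ (inner i d))
      ≤⟨ Incidence.∑-incident-≤ (H i) x (λ d → ℓ≤position (inner i d) K (below d)) ⟩
    deg i x * position K ∎

  inner-weight-≥ : ∀ i x K → (∀ d → K ≺ κ (inner i d)) → deg i x * position K ≤ inner-weight i x
  inner-weight-≥ i x K above = begin
    deg i x * position K
      ≤⟨ Incidence.∑-incident-≥ (H i) x (λ d → ℕ.<⇒≤ (position<ℓ (inner i d) K (above d))) ⟩
    ∑-incident (H i) x (λ d → ℓ (inner i d)) ≡⟨ inner-weight≡ i x ⟨
    inner-weight i x ∎

  W-new-< : ∀ i j x y → inner-weight i x ≤ inner-weight j y →
            κ (join₁ i x) ≺ κ (join₁ j y) → κ (join₂ i x) ≺ κ (join₂ j y) →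
            W (new i x) < W (new j y)
  W-new-< i j x y p q₁ q₂ = subst₂ _<_ (sym (W-new i x)) (sym (W-new j y))
    (ℕ.+-mono-≤-< p (ℕ.+-mono-< (ℓ-mono (join₁ i x) (join₁ j y) q₁)
                                (ℓ-mono (join₂ i x) (join₂ j y) q₂)))

  -- The tie begins with the inner sum and orders both bundles, so all three parts of the weight
  -- move in the same direction. Vertices with equal inner sums are separated by the bundles.
  W-new-within : ∀ i x y → tie inner-weight i x ≺ tie inner-weight i y → W (new i x) < W (new i y)
  W-new-within i x y x≺y = W-new-< i i x y (head-≤ x≺y)
    (next refl (next refl (next refl x≺y))) (next refl (next refl (next refl x≺y)))
    where
    head-≤ : ∀ {m n K L} → m ∷ K ≺ n ∷ L → m ≤ n
    head-≤ (this m<n)    = ℕ.<⇒≤ m<n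
    head-≤ (next refl _) = ℕ.≤-refl

  join₁-≺ : ∀ i j x y → toℕ i < toℕ j → κ (join₁ i x) ≺ κ (join₁ j y)
  join₁-≺ zero    (suc j) x y i<j = this (s≤s z≤n)
  join₁-≺ (suc i) (suc j) x y i<j = next refl (this i<j)

  -- Each label inside `H i` is below each label inside `H j`, and `y` has at least as many inner
  -- edges as `x`; the bundle labels are ordered by fibre. The threshold `K` separates the two sets
  -- of inner labels.
  W-new-across : ∀ i j x y → toℕ i < toℕ j → W (new i x) < W (new j y)
  W-new-across i j x y i<j = W-new-< i j x y
    (begin
      inner-weight i x
        ≤⟨ inner-weight-≤ i x K (λ _ → next refl (this i<j)) ⟩
      deg i x * position K
        ≤⟨ ℕ.*-monoˡ-≤ (position K) (deg-mono i j i<j x y) ⟩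
      deg j y * position K
        ≤⟨ inner-weight-≥ j y K (λ _ → next refl (next refl halt)) ⟩
      inner-weight j y ∎)
    (join₁-≺ i j x y i<j) (next refl (this i<j))
    where
    K : Key
    K = 2 ∷ toℕ j ∷ []

  -- By order₀≤1+deg, x has at least as many edges as u₀; they have exactly one edge in
  -- common, and every other label at x exceeds every label at u₀.
  W-u₀<new₀ : ∀ x → W (old zero) < W (new zero x)
  W-u₀<new₀ x = begin-strict
    W (old zero)
      ≡⟨ incident-u₀ ⟩
    ℓ (base zero) + ∑ (finite-V (H zero)) J₁
      ≤⟨ ℕ.+-monoˡ-≤ _ (ℓ≤position (base zero) K (this (s≤s (s≤s z≤n)))) ⟩
    c + ∑ (finite-V (H zero)) J₁
      ≡⟨ ℕ.+-comm c _ ⟩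
    ∑ (finite-V (H zero)) J₁ + c
      ≤⟨ ∑-bound-except (finite-V (H zero)) J₁
           (λ y → ℓ≤position (join₁ zero y) K (this (s≤s z≤n))) x ⟩
    J₁ x + order (H zero) * c
      ≤⟨ ℕ.+-monoʳ-≤ (J₁ x) (ℕ.*-monoˡ-≤ c (order₀≤1+deg x)) ⟩
    J₁ x + (c + deg zero x * c)
      <⟨ ℕ.+-monoʳ-< (J₁ x) (ℕ.+-mono-<-≤
           (position<ℓ (join₂ zero x) K (this (s≤s (s≤s (s≤s z≤n)))))
           (inner-weight-≥ zero x K (λ _ → next refl halt))) ⟩
    J₁ x + (ℓ (join₂ zero x) + inner-weight zero x)
      ≡⟨ ℕ.+-assoc (J₁ x) _ _ ⟨
    J₁ x + ℓ (join₂ zero x) + inner-weight zero x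
      ≡⟨ ℕ.+-comm (J₁ x + ℓ (join₂ zero x)) _ ⟩
    inner-weight zero x + (J₁ x + ℓ (join₂ zero x))
      ≡⟨ W-new zero x ⟨
    W (new zero x) ∎
    where
    K : Key
    K = 2 ∷ []
    c : ℕ
    c = position K
    J₁ : V (H zero) → ℕ
    J₁ y = ℓ (join₁ zero y)

  W-u₀<new : ∀ i x → W (old zero) < W (new i x)
  W-u₀<new zero    x = W-u₀<new₀ x
  W-u₀<new (suc i) x =
    ℕ.<-trans (W-u₀<new₀ (some zero)) (W-new-across zero (suc i) (some zero) x (s≤s z≤n))

  order*≤∑ : ∀ i c (f : V (H i) → ℕ) → (∀ x → c ≤ f x) → order (H i) * c ≤ ∑ (finite-V (H i)) f
  order*≤∑ i c f c≤f = begin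
    order (H i) * c                ≡⟨ ∑-const (finite-V (H i)) c ⟨
    ∑ (finite-V (H i)) (λ _ → c)   ≤⟨ ∑-mono-≤ (finite-V (H i)) {g = f} c≤f ⟩
    ∑ (finite-V (H i)) f           ∎

  ∑≤order* : ∀ i c (f : V (H i) → ℕ) → (∀ x → f x ≤ c) → ∑ (finite-V (H i)) f ≤ order (H i) * c
  ∑≤order* i c f f≤c = begin
    ∑ (finite-V (H i)) f           ≤⟨ ∑-mono-≤ (finite-V (H i)) {f = f} f≤c ⟩
    ∑ (finite-V (H i)) (λ _ → c)   ≡⟨ ∑-const (finite-V (H i)) c ⟩
    order (H i) * c                ∎

  -- The inner edges at `x` are outnumbered in the weak sense by the edges from u₁ to H₁ and H₂,
  -- whose labels come later. The two bundle edges at `x` are matched with u₁u₂ and u₁u₃ in the last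
  -- group.
  W-new-last<u₁ : ∀ x → W (new last x) < W (old 1F)
  W-new-last<u₁ x = begin-strict
    W (new last x)
      ≡⟨ W-new last x ⟩
    inner-weight last x + (ℓ (join₁ last x) + ℓ (join₂ last x))
      <⟨ ℕ.+-mono-≤-< inner≤ (ℕ.+-mono-< (ℓ-mono (join₁ last x) (base 1F) (this ℕ.≤-refl))
                                         (ℓ-mono (join₂ last x) (base 2F) (this ℕ.≤-refl))) ⟩
    S 1F + S 2F + (ℓ (base 1F) + ℓ (base 2F))
      ≡⟨ ℕ.+-comm (S 1F + S 2F) _ ⟩
    ℓ (base 1F) + ℓ (base 2F) + (S 1F + S 2F)
      ≡⟨ interchange (ℓ (base 1F)) (ℓ (base 2F)) (S 1F) (S 2F) ⟩
    star₁ 1F + star₁ 2F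
      ≡⟨ incident-u₁ ⟨
    W (old 1F) ∎
    where
    K : Key
    K = 3 ∷ []
    c : ℕ
    c = position K
    S : Fin (4 + k) → ℕ
    S i = ∑ (finite-V (H i)) (λ y → ℓ (join₁ i y))
    order*c≤S : ∀ i → order (H (suc i)) * c ≤ S (suc i)
    order*c≤S i = order*≤∑ (suc i) c (λ y → ℓ (join₁ (suc i) y)) λ y →
      ℕ.<⇒≤ (position<ℓ (join₁ (suc i) y) K (next refl halt))
    inner≤ : inner-weight last x ≤ S 1F + S 2F
    inner≤ = begin
      inner-weight last x
        ≤⟨ inner-weight-≤ last x K (λ _ → this ℕ.≤-refl) ⟩
      deg last x * c
        ≤⟨ ℕ.*-monoˡ-≤ c (deg-last≤ x) ⟩
      (order (H 1F) + order (H 2F)) * c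
        ≡⟨ ℕ.*-distribʳ-+ c (order (H 1F)) (order (H 2F)) ⟩
      order (H 1F) * c + order (H 2F) * c
        ≤⟨ ℕ.+-mono-≤ (order*c≤S zero) (order*c≤S 1F) ⟩
      S 1F + S 2F ∎

  W-new<u₁ : ∀ i x → W (new i x) < W (old 1F)
  W-new<u₁ i = go (view i)
    where
    inject₁<last : ∀ {n} (i : Fin n) → toℕ (inject₁ i) < toℕ (fromℕ n)
    inject₁<last {n} i = subst₂ _<_ (sym (Fin.toℕ-inject₁ i)) (sym (Fin.toℕ-fromℕ n)) (Fin.toℕ<n i)
    go : ∀ {i} → View i → ∀ x → W (new i x) < W (old 1F)
    go ‵fromℕ       x = W-new-last<u₁ x
    go (‵inject₁ i) x = ℕ.<-trans (W-new-across (inject₁ i) last x (some last) (inject₁<last i))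
                                  (W-new-last<u₁ (some last))

  -- Weights along the cycle.

  star-< : ∀ i j → toℕ i < toℕ j → (c : ∀ i → V (H i) → E Γ) →
           (∀ x → κ (c (suc i) x) ≺ 3 ∷ toℕ (suc j) ∷ []) →
           (∀ x → 3 ∷ toℕ (suc j) ∷ [] ≺ κ (c (suc j) x)) →
           ℓ (base (suc i)) + ∑ (finite-V (H (suc i))) (λ x → ℓ (c (suc i) x)) <
           ℓ (base (suc j)) + ∑ (finite-V (H (suc j))) (λ x → ℓ (c (suc j) x))
  star-< i j i<j c below above = ℕ.+-mono-<-≤
    (ℓ-mono (base (suc i)) (base (suc j)) (next refl (this (s≤s i<j))))
    (begin
      ∑ (finite-V (H (suc i))) (λ x → ℓ (c (suc i) x))
        ≤⟨ ∑≤order* (suc i) p (λ x → ℓ (c (suc i) x))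
             (λ x → ℓ≤position (c (suc i) x) K (below x)) ⟩
      order (H (suc i)) * p
        ≤⟨ ℕ.*-monoˡ-≤ p (order-mono (suc i) (suc j) (s≤s i<j)) ⟩
      order (H (suc j)) * p
        ≤⟨ order*≤∑ (suc j) p (λ x → ℓ (c (suc j) x))
             (λ x → ℕ.<⇒≤ (position<ℓ (c (suc j) x) K (above x))) ⟩
      ∑ (finite-V (H (suc j))) (λ x → ℓ (c (suc j) x)) ∎)
    where
    K : Key
    K = 3 ∷ toℕ (suc j) ∷ []
    p : ℕ
    p = position K

  star₁-< : ∀ i j → toℕ i < toℕ j → star₁ (suc i) < star₁ (suc j)
  star₁-< i j i<j = star-< i j i<j (λ i x → join₁ i x)
    (λ _ → next refl (this (s≤s i<j))) (λ _ → next refl (next refl halt))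

  star₂-< : ∀ i j → toℕ i < toℕ j → star₂ (suc i) < star₂ (suc j)
  star₂-< i j i<j = star-< i j i<j (λ i x → join₂ i x)
    (λ _ → next refl (this (s≤s i<j))) (λ _ → next refl (next refl halt))

  <⇒mono-≤ : ∀ {n} (f : Fin n → ℕ) → (∀ i j → toℕ i < toℕ j → f i < f j) →
             ∀ i j → toℕ i ≤ toℕ j → f i ≤ f j
  <⇒mono-≤ f mono i j i≤j with ℕ.m≤n⇒m<n∨m≡n i≤j
  ... | inj₁ i<j = ℕ.<⇒≤ (mono i j i<j)
  ... | inj₂ i≡j = ℕ.≤-reflexive (cong f (Fin.toℕ-injective i≡j))

  star₁-≤ : ∀ i j → toℕ i ≤ toℕ j → star₁ (suc i) ≤ star₁ (suc j)
  star₁-≤ = <⇒mono-≤ (star₁ ∘ suc) star₁-<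

  star₂-≤ : ∀ i j → toℕ i ≤ toℕ j → star₂ (suc i) ≤ star₂ (suc j)
  star₂-≤ = <⇒mono-≤ (star₂ ∘ suc) star₂-<

  -- The third entry of the key places the whole first bundle before the second; strictness of the
  -- sum needs a vertex in the fibre.
  star₁<star₂ : ∀ i → star₁ (suc i) < star₂ (suc i)
  star₁<star₂ i = ℕ.+-monoʳ-< (ℓ (base (suc i)))
    (∑-mono-< (finite-V (H (suc i))) {λ x → ℓ (join₁ (suc i) x)} {λ x → ℓ (join₂ (suc i) x)}
      (λ x → ℕ.<⇒≤ (join₁<join₂ x)) (some (suc i)) (join₁<join₂ (some (suc i))))
    where
    join₁<join₂ : ∀ x → ℓ (join₁ (suc i) x) < ℓ (join₂ (suc i) x)
    join₁<join₂ x = ℓ-mono (join₁ (suc i) x) (join₂ (suc i) x) (next refl (next refl (this (s≤s z≤n))))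

  -- A lower bound common to u_2, ..., u_r, so that u_r needs no separate comparison. With j = m +
  -- 2, the term `star₁` of e_j is at most the true term: `star₁` of e_{j+1} if j < r, and `star₂`
  -- of e_r if j = r.
  W-old-≥ : ∀ {m} → View m → star₁ (suc (suc m)) + star₂ (suc (inject₁ m)) ≤ W (old (suc (suc m)))
  W-old-≥ (‵inject₁ i) = begin
    star₁ (suc (suc (inject₁ i))) + star₂ (suc (inject₁ (inject₁ i)))
      ≤⟨ ℕ.+-monoˡ-≤ _ (star₁-≤ (suc (inject₁ i)) (suc (suc i))
           (s≤s (ℕ.≤-trans (ℕ.≤-reflexive (Fin.toℕ-inject₁ i)) (ℕ.n≤1+n (toℕ i))))) ⟩
    star₁ (suc (suc (suc i))) + star₂ (suc (inject₁ (inject₁ i)))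
      ≡⟨ incident-middle i ⟨
    W (old (suc (suc (inject₁ i)))) ∎
  W-old-≥ ‵fromℕ = begin
    star₁ last + star₂ (suc (inject₁ last))
      ≤⟨ ℕ.+-monoˡ-≤ _ (ℕ.<⇒≤ (star₁<star₂ last)) ⟩
    star₂ last + star₂ (suc (inject₁ last))
      ≡⟨ ℕ.+-comm (star₂ last) _ ⟩
    star₂ (suc (inject₁ last)) + star₂ last
      ≤⟨ incident-last ⟩
    W (old last) ∎

  W-old-< : ∀ i j → toℕ i < toℕ j → W (old (suc i)) < W (old (suc j))
  W-old-< zero (suc m) _ = begin-strict
    W (old 1F)
      ≡⟨ incident-u₁ ⟩
    star₁ 1F + star₁ 2F
      -- The pairing is crossed: e_1 at its first end goes against e_{j-1} at its second end, where
      -- u_j is the other vertex. This is what makes the inequality strict even for j = 2, when both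
      -- are e_1.
      <⟨ ℕ.+-mono-<-≤ (ℕ.<-≤-trans (star₁<star₂ zero) (star₂-≤ zero (inject₁ m) z≤n))
                      (star₁-≤ 1F (suc m) (s≤s z≤n)) ⟩
    star₂ (suc (inject₁ m)) + star₁ (suc (suc m))
      ≡⟨ ℕ.+-comm (star₂ (suc (inject₁ m))) _ ⟩
    star₁ (suc (suc m)) + star₂ (suc (inject₁ m))
      ≤⟨ W-old-≥ (view m) ⟩
    W (old (suc (suc m))) ∎
  W-old-< (suc l) (suc m) (s≤s l<m) = go (view l) l<m
    where
    go : ∀ {l} → View l → toℕ l < toℕ m → W (old (suc (suc l))) < W (old (suc (suc m)))
    go ‵fromℕ       l<m = contradiction (subst (_< toℕ m) (Fin.toℕ-fromℕ (suc k)) l<m)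
                                   (ℕ.≤⇒≯ (ℕ.≤-pred (Fin.toℕ<n m)))
    go (‵inject₁ i) l<m = begin-strict
      W (old (suc (suc (inject₁ i))))
        ≡⟨ incident-middle i ⟩
      star₁ (suc (suc (suc i))) + star₂ (suc (inject₁ (inject₁ i)))
        -- For u_a and u_b with a < b, e_{a+1} may coincide with e_b, so strictness is taken from
        -- e_{a-1} and e_{b-1}.
        <⟨ ℕ.+-mono-≤-< (star₁-≤ (suc (suc i)) (suc m) (s≤s (subst (_< toℕ m) (Fin.toℕ-inject₁ i) l<m)))
                        (star₂-< (inject₁ (inject₁ i)) (inject₁ m)
                           (subst₂ _<_ (sym (Fin.toℕ-inject₁ (inject₁ i))) (sym (Fin.toℕ-inject₁ m)) l<m)) ⟩
      star₁ (suc (suc m)) + star₂ (suc (inject₁ m))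
        ≤⟨ W-old-≥ (view m) ⟩
      W (old (suc (suc m))) ∎

  W-u₀<old : ∀ i → W (old zero) < W (old (suc i))
  W-u₀<old zero    = ℕ.<-trans (W-u₀<new₀ (some zero)) (W-new<u₁ zero (some zero))
  W-u₀<old (suc i) = ℕ.<-trans (W-u₀<old zero) (W-old-< zero (suc i) (s≤s z≤n))

  W-new<old : ∀ i x j → W (new i x) < W (old (suc j))
  W-new<old i x zero    = W-new<u₁ i x
  W-new<old i x (suc j) = ℕ.<-trans (W-new<u₁ i x) (W-old-< zero (suc j) (s≤s z≤n))

  -- Distinctness of all weights.

  <⊎>⇒≢ : ∀ {m n} → m < n ⊎ n < m → m ≢ n
  <⊎>⇒≢ = ⊎.[ ℕ.<⇒≢ , ℕ.>⇒≢ ]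

  W-distinct : ∀ v w → v ≢ w → W v ≢ W w
  W-distinct (old zero)    (old zero)    v≢w = contradiction refl v≢w
  W-distinct (old zero)    (old (suc j)) v≢w = ℕ.<⇒≢ (W-u₀<old j)
  W-distinct (old (suc i)) (old zero)    v≢w = ℕ.>⇒≢ (W-u₀<old i)
  W-distinct (old (suc i)) (old (suc j)) v≢w =
    <⊎>⇒≢ (⊎.map (W-old-< i j) (W-old-< j i)
      (≉⇒<⊎> ℕ.<-cmp (v≢w ∘ cong (λ i → old (suc i)) ∘ Fin.toℕ-injective)))
  W-distinct (old zero)    (new j y)     v≢w = ℕ.<⇒≢ (W-u₀<new j y)
  W-distinct (old (suc i)) (new j y)     v≢w = ℕ.>⇒≢ (W-new<old j y i)
  W-distinct (new i x)     (old zero)    v≢w = ℕ.>⇒≢ (W-u₀<new i x)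
  W-distinct (new i x)     (old (suc j)) v≢w = ℕ.<⇒≢ (W-new<old i x j)
  W-distinct (new i x)     (new j y)     v≢w = go (i Fin.≟ j) y v≢w
    where
    go : ∀ {j} → Dec (i ≡ j) → ∀ y → new i x ≢ new j y → W (new i x) ≢ W (new j y)
    go (yes refl) y v≢w = <⊎>⇒≢ (⊎.map (W-new-within i x y) (W-new-within i y x)
      (≉⇒<⊎> (Lex.<-compare sym ℕ.<-cmp)
        (v≢w ∘ cong (λ x → new i x) ∘ tie-injective inner-weight)))
    go {j} (no i≢j) y v≢w = <⊎>⇒≢ (⊎.map (W-new-across i j x y) (W-new-across j i y x)
      (≉⇒<⊎> ℕ.<-cmp (i≢j ∘ Fin.toℕ-injective)))

  antimagic : Antimagic Γ
  antimagic = ranking , λ {v} {w} eq →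
    -- Decidable equality of vertices turns the contrapositive `W-distinct` into injectivity.
    decidable-stable (Finite._≟_ (finite-V Γ) v w) λ v≢w → W-distinct v w v≢w eq

theorem1 : (r : ℕ) (3≤r : 3 ≤ r) (H : Fin (suc r) → Graph) →
    let G₁ = pan r 3≤r
        Γ  = G₁ ⋄ H
    in
    (∀ i → Connected (H i)) →
    (∀ i → 2 ≤ order (H i)) →
    (∀ (i : Fin r) → order (H (inject₁ i)) ≤ order (H (suc i))) →
    Δ (H zero) < δ (H (one 3≤r)) →
    (∀ (i : Fin r) → 1 ≤ toℕ i → Δ (H (inject₁ i)) ≤ δ (H (suc i))) →
    (∀ i → degree Γ (old zero) ≤ δ′ G₁ H i) →
    Δ′ G₁ H last ≤ degree Γ (old (one 3≤r)) →
    Antimagic Γ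
theorem1 (suc (suc (suc k))) (s≤s (s≤s (s≤s z≤n))) H _ order≥2 order-step Δ₀<δ₁ Δ≤δ u₀≤δ′ Δ′≤u₁ =
  Weights.antimagic k H order≥2 order-step Δ≤δ₀ (u₀≤δ′ zero) Δ′≤u₁
  where
  -- Conditions (a) and (b) are merged into one weak chain, (a) supplying the step from H₀ to H₁.
  Δ≤δ₀ : ∀ i → Δ (H (inject₁ i)) ≤ δ (H (suc i))
  Δ≤δ₀ zero    = ℕ.<⇒≤ Δ₀<δ₁
  Δ≤δ₀ (suc i) = Δ≤δ (suc i) (s≤s z≤n)
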